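{- Suppose that agent $A_i$ with label $\ell(A_i)$ initially occupies node $v_i$ of the graph $G$, $i\in\{1,2\}$, where $v_1\neq v_2$ and $\ell(A_1)\neq\ell(A_2)$, and that both distance-aware agents start executing the procedure Rendezvous (given in full in the context) in the same round. Then procedure Rendezvous guarantees that $A_1$ and $A_2$ rendezvous within $$O\Bigl(\Delta\cdot\bigl(D+\min_{i\in\{1,2\}}\{\log \ell(A_i)\}\bigr)\Bigr)$$ rounds, where $D=\mathrm{dist}(v_1,v_2)$ and $\Delta$ is the bound on the degrees of the nodes of $G$.
   Context: Model. $G=(V,E)$ is an undirected connected, possibly infinite, graph. Nodes are anonymous (unlabelled). At each node $v$ the incident edges are locally labelled by distinct port numbers from $\{1,\dots,d(v)\}$, where $d(v)$ is the degree of $v$. The degree of each node is finite and bounded by the parameter $\Delta$, which is unknown to the agents. $\mathrm{dist}(u,v)$ is the number of edges in a shortest path from $u$ to $v$. There are exactly two agents $A_1,A_2$, with distinct labels $\ell(A_1),\ell(A_2)\in\{0,1,\dots,L-1\}$ for some integer $L\ge 1$. An agent knows its own label but not that of the other agent, and has no prior knowledge of the graph. The agents start at distinct nodes in the same round and move in synchronous rounds: in each round an agent at $v$ either stays at $v$ or moves to an adjacent node through a chosen port, and on arrival learns the port number of the edge through which it entered. Agents cannot mark nodes or communicate, and one sees the other only when both are at the same node (not when they cross on an edge). Agents are distance-aware: the command distance() returns $\mathrm{dist}(v,u)$, where $v$ is the current node of the executing agent and $u$ is the current node of the other agent. Memory is unrestricted. Rendezvous is achieved in the earliest round in which both agents are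 at the same node. Command move($x$), for an integer $x$, takes one round. If $x\in\{1,\dots,d(v)\}$, where $v$ is the node currently occupied by the executing agent, the agent moves from $v$ through port $x$, and the value returned is the entry port at the arrival node. Otherwise the agent stays idle in that round and the value returned is $0$. Procedure TestPorts($\delta,b$), for integers $\delta\ge 1$ and $b\in\{0,1\}$: for $i=1,\dots,\delta$ do: $x\leftarrow$ distance(); $p\leftarrow$ move($i\cdot b$); $y\leftarrow$ distance(); if $y<x$, return success; otherwise execute move($p\cdot b$) (going back along the same edge). After the loop, return failure. Procedure BoundDegrees($b$), for $b\in\{0,1\}$: let $v$ be the currently occupied node. For $l=0,\dots,\lceil\log_2 d(v)\rceil-1$ do: $s\leftarrow$ TestPorts($2^l,0$); if $s=$ success, return success. After the loop, $s\leftarrow$ TestPorts($2^{\lceil\log_2 d(v)\rceil},b$); return $s$. Extended label. For a label $\ell$, let $\ell_j$ denote its $j$-th bit. The extended label $\xi(\ell)$ is the integer whose $j$-th bit is $$\xi(\ell)_j=\begin{cases}\ell_{\lceil j/2\rceil}, & j\in\{1,3,5,\dots,2\lceil\log_2\ell\rceil-1\},\\ 1, & j=2\lceil\log_2\ell\rceil,\\ 0,&\text{otherwise.}\end{cases}$$ (Informally, the odd positions of $\xi(\ell)$ are the bits of $\ell$, while the even positions are all zeros, except for the last bit set to $1$, called the terminating bit.) Procedure CompareLabels (no input): let $\xi(\ell)$ be the extended label of the executing agent. For $i=1,\dots,\lceil\log_2\xi(\ell)\rceil$ do: $s\leftarrow$ BoundDegrees($\xi(\ell)_i$); if $s=$ success,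 return $\xi(\ell)_i$. Procedure Rendezvous: (1) $s\leftarrow$ success. (2) While rendezvous is not achieved and $s=$ success, do $s\leftarrow$ BoundDegrees($1$). (3) $b\leftarrow$ CompareLabels. (4) While rendezvous is not achieved, do BoundDegrees($b$).
   Formalization: In the extended label and in CompareLabels, ⌈log₂ x⌉ is read as the number of binary digits of x (one digit for 0), bits counted from the least significant; as printed it is undefined for label 0 and fails to separate labels such as 2 and 4. -}

module Defs where

open import Data.Bool.Base using (Bool; true; false; if_then_else_; _∧_)
open import Data.Digit using (Bit; 0b; 1b; fromDigits)
open import Data.Fin.Base using (Fin; toℕ; fromℕ<)
open import Data.List.Base using (List; []; _∷_; applyUpTo; upTo)
open import Data.Maybe.Base using (Maybe; just; nothing)
open import Data.Nat.Base
  using (ℕ; zero; suc; _+_; _*_; _∸_; _^_; _/_; _%_; _≤_; _≤ᵇ_; _<ᵇ_; _≡ᵇ_; ⌈_/2⌉)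
open import Data.Nat.DivMod using (_mod_)
open import Data.Nat.GeneralisedArithmetic using (iterate)
open import Data.Nat.Logarithm using (⌊log₂_⌋; ⌈log₂_⌉)
open import Data.Nat.Properties using (m^n≢0; _<?_)
open import Data.Product.Base using (∃-syntax; _×_; _,_)
open import Data.Unit.Base using (⊤; tt)
open import Function.Base using (_∘_)
open import Function.Definitions using (Injective)
open import Relation.Binary.PropositionalEquality using (_≡_)
open import Relation.Nullary using (¬_; yes; no)

------------------------------------------------------------------------
-- Graphs, distance, port numbers

-- Walk _~_ n u v: a walk with n edges from u to v.
data Walk {V : Set} (_~_ : V → V → Set) : ℕ → V → V → Set where
  []  : ∀ {v} → Walk _~_ 0 v v
  _∷_ : ∀ {n u v w} → u ~ v → Walk _~_ n v w → Walk _~_ (suc n) u w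

record Graph : Set₁ where
  field
    V         : Set
    _~_       : V → V → Set
    ~-sym     : ∀ {u v} → u ~ v → v ~ u
    ~-irrefl  : ∀ {v} → ¬ (v ~ v)
    connected : ∀ u v → ∃[ n ] Walk _~_ n u v

-- These two properties determine dist uniquely.  Since V may be infinite
-- and has no decidable equality, dist is described rather than computed.
record IsDistance (G : Graph) (dist : Graph.V G → Graph.V G → ℕ) : Set where
  open Graph G
  field
    attained : ∀ u v → Walk _~_ (dist u v) u v
    shortest : ∀ {n u v} → Walk _~_ n u v → dist u v ≤ n

-- nbr v is a bijection from Fin (deg v) to the neighbours of v; the
-- element p : Fin (deg v) stands for the port number suc (toℕ p).  The
-- numbers at the two ends of an edge are unrelated.
record PortLabelling (G : Graph) : Set where
  open Graph G
  field
    deg        : V → ℕ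
    nbr        : ∀ v → Fin (deg v) → V
    adjacent   : ∀ v p → v ~ nbr v p
    injective  : ∀ v → Injective _≡_ _≡_ (nbr v)
    port       : ∀ {v w} → v ~ w → Fin (deg v)
    nbr-port   : ∀ {v w} (e : v ~ w) → nbr v (port e) ≡ w

  entryPort : ∀ v (p : Fin (deg v)) → Fin (deg (nbr v p))
  entryPort v p = port (~-sym (adjacent v p))

------------------------------------------------------------------------
-- Agent programs

-- degree reads the degree of the current node.  Arguments of move are
-- natural numbers because no procedure below passes a negative one.
data Prog : Set → Set₁ where
  return   : ∀ {A} → A → Prog A
  _>>=_    : ∀ {A B} → Prog A → (A → Prog B) → Prog B
  distance : Prog ℕ
  degree   : Prog ℕ
  move     : ℕ → Prog ℕ
  while    : ∀ {S} → (S → Prog Bool) → (S → Prog S) → S → Prog S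

infixl 1 _>>=_ _>>_

_>>_ : ∀ {A B} → Prog A → Prog B → Prog B
m >> k = m >>= λ _ → k

-- Run body on the successive elements of a list; the first `just a` leaves
-- the enclosing procedure with result a, and otherwise `after` is run.
for : {I A : Set} → List I → (I → Prog (Maybe A)) → Prog A → Prog A
for []       body after = after
for (i ∷ is) body after = body i >>= λ where
  (just a) → return a
  nothing  → for is body after

data Outcome : Set where
  success failure : Outcome

isSuccess : Outcome → Bool
isSuccess success = true
isSuccess failure = false

------------------------------------------------------------------------
-- Binary labels

-- The number of binary digits of n, where 0 has the single digit 0.  In the
-- definition of extended labels ⌈log₂ n⌉ is used with this meaning; it
-- differs from the number of digits exactly when n is 0 or a power of two.
bitLength : ℕ → ℕ
bitLength n = suc ⌊log₂ n ⌋

-- The j-th bit, j ≥ 1, bit 1 being the least significant.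
bit : ℕ → ℕ → Bit
bit n j = (n / 2 ^ (j ∸ 1)) mod 2
  where instance _ = m^n≢0 2 (j ∸ 1)

ξ-bit : ℕ → ℕ → Bit
ξ-bit ℓ j =
  if (j % 2 ≡ᵇ 1) ∧ (j ≤ᵇ 2 * bitLength ℓ ∸ 1) then bit ℓ ⌈ j /2⌉
  else if j ≡ᵇ 2 * bitLength ℓ then 1b
  else 0b

-- fromDigits expects the least significant bit first; all bits of ξ ℓ at
-- positions beyond 2 * bitLength ℓ are zero.
ξ : ℕ → ℕ
ξ ℓ = fromDigits (applyUpTo (ξ-bit ℓ ∘ suc) (2 * bitLength ℓ))

------------------------------------------------------------------------
-- The procedures

testPorts : ℕ → Bit → Prog Outcome
testPorts δ b = for (applyUpTo suc δ) attempt (return failure)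
  where
  attempt : ℕ → Prog (Maybe Outcome)
  attempt i = do
    x ← distance
    p ← move (i * toℕ b)
    y ← distance
    if y <ᵇ x
      then return (just success)
      else (move (p * toℕ b) >> return nothing)

boundDegrees : Bit → Prog Outcome
boundDegrees b = do
  d ← degree
  for (upTo ⌈log₂ d ⌉) passive (testPorts (2 ^ ⌈log₂ d ⌉) b)
  where
  passive : ℕ → Prog (Maybe Outcome)
  passive l = do
    s ← testPorts (2 ^ l) 0b
    return (if isSuccess s then just success else nothing)

-- The result is `nothing` if the loop ends without returning a bit, a case
-- in which the procedure specifies no value.
compareLabels : ℕ → Prog (Maybe Bit)
compareLabels ℓ =
  for (applyUpTo suc (bitLength (ξ ℓ))) tryBit (return nothing)
  where
  tryBit : ℕ → Prog (Maybe (Maybe Bit))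
  tryBit i = do
    s ← boundDegrees (bit (ξ ℓ) i)
    return (if isSuccess s then just (just (bit (ξ ℓ) i)) else nothing)

-- "Rendezvous is not achieved", tested on the current positions.  This
-- agrees with the history up to and including the first meeting, and
-- behaviour after the first meeting is irrelevant.
apart : Prog Bool
apart = distance >>= λ x → return (0 <ᵇ x)

-- If compareLabels gives no bit then the agent simply stops.
rendezvous : ℕ → Prog ⊤
rendezvous ℓ = do
  while continue (λ _ → boundDegrees 1b) success
  compareLabels ℓ >>= λ where
    nothing  → return tt
    (just b) → while (λ _ → apart) (λ _ → boundDegrees b >> return tt) tt
  where
  continue : Outcome → Prog Bool
  continue s = apart >>= λ a → return (a ∧ isSuccess s)

------------------------------------------------------------------------
-- Synchronous execution

record Obs : Set where
  field
    distanceNow degreeNow : ℕ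

-- A program either can perform a computation step that takes no time, or is
-- ready for the next round: it is at a move command or has finished.
data Ready (A : Set) : Set₁ where
  done   : A → Ready A
  moving : ℕ → (ℕ → Prog A) → Ready A

data View (A : Set) : Set₁ where
  local : (Obs → Prog A) → View A
  ready : Ready A → View A

view : ∀ {A} → Prog A → View A
view (return a)   = ready (done a)
view (m >>= k) with view m
... | local f            = local (λ o → f o >>= k)
... | ready (done a)     = local (λ _ → k a)
... | ready (moving x f) = ready (moving x (λ p → f p >>= k))
view distance     = local (λ o → return (Obs.distanceNow o))
view degree       = local (λ o → return (Obs.degreeNow o))
view (move x)     = ready (moving x return)
view (while c body s) = local λ _ → c s >>= λ where
  true  → body s >>= while c body
  false → return s

module Execution (G : Graph) (P : PortLabelling G)
                 (dist : Graph.V G → Graph.V G → ℕ) where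
  open Graph G using (V)
  open PortLabelling P

  -- The new position and the value returned by move x at v.
  moveFrom : V → ℕ → V × ℕ
  moveFrom v zero    = v , 0
  moveFrom v (suc k) with k <? deg v
  ... | yes k<d = nbr v (fromℕ< k<d) , suc (toℕ (entryPort v (fromℕ< k<d)))
  ... | no  _   = v , 0

  record Agent : Set₁ where
    constructor _at_
    field
      program  : Prog ⊤
      position : V
  open Agent public

  record Config : Set₁ where
    field
      agent₁ agent₂ : Agent
      round         : ℕ   -- number of rounds completed so far
  open Config public

  -- What `self` observes when the other agent is at `other`.
  observe : (self other : V) → Obs
  observe self other = record { distanceNow = dist self other
                              ; degreeNow   = deg self }

  act : Ready ⊤ → V → Agent
  act (done a)     v = return a at v
  act (moving x f) v = let (w , p) = moveFrom v x in f p at w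

  -- Computation steps leave both positions fixed, so the order in which the
  -- two agents perform them is immaterial.  A round takes place once both
  -- agents are ready.
  step : Config → Config
  step c with view (program (agent₁ c)) | view (program (agent₂ c))
  ... | local f  | _        = record c
    { agent₁ = f (observe (position (agent₁ c)) (position (agent₂ c)))
               at position (agent₁ c) }
  ... | ready _  | local g  = record c
    { agent₂ = g (observe (position (agent₂ c)) (position (agent₁ c)))
               at position (agent₂ c) }
  ... | ready r₁ | ready r₂ = record
    { agent₁ = act r₁ (position (agent₁ c))
    ; agent₂ = act r₂ (position (agent₂ c))
    ; round  = suc (round c) }

  start : (ℓ₁ ℓ₂ : ℕ) (v₁ v₂ : V) → Config
  start ℓ₁ ℓ₂ v₁ v₂ = record { agent₁ = rendezvous ℓ₁ at v₁
                             ; agent₂ = rendezvous ℓ₂ at v₂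
                             ; round  = 0 }

  -- Both agents are at the same node after at most T rounds of the (unique)
  -- execution; n counts rounds and computation steps together.
  RendezvousWithin : ℕ → Config → Set
  RendezvousWithin T c =
    ∃[ n ] (let c′ = iterate step c n in
            position (agent₁ c′) ≡ position (agent₂ c′) × round c′ ≤ T)

{-# OPTIONS --safe #-}
module Submission where

-- A try takes two rounds, or one if it decreases the distance.  Both agents
-- see the same distances, so they begin and end their tries together and
-- notice success together.
--
-- An agent of degree d with k = ⌈log₂ d⌉ idles for 2 ^ k ∸ 1 tries in
-- boundDegrees and then tests 2 ^ k ≥ d ports, which is less than
-- 2 ^ suc k tries in total.  If the agents have different k, the one
-- with the smaller k tests all its ports while the other idles, hence one of
-- its tries succeeds.  If they have the same k, then boundDegrees 1b succeeds
-- or fails for both at the same time.  Thus the search loop decreases the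
-- distance in every iteration until a common failure, which leaves the agents
-- at nodes with equal k.  Testing ports together was then unsuccessful, so in
-- compareLabels nothing happens as long as the bits agree; at the first
-- disagreement one agent is active while the other idles, which gives success
-- and assigns different bits.  From then on only one agent moves, and each of
-- its calls of boundDegrees 1b decreases the distance.

open import Defs
open import Data.Bool.Base using (Bool; true; false; if_then_else_)
open import Data.Bool.Properties using (T-≡)
open import Data.Digit using (Bit; 0b; 1b; fromDigits)
open import Data.Fin.Base using (Fin; toℕ; zero; suc)
import Data.Fin.Properties as Fin
open import Data.Fin.Properties using (toℕ<n; fromℕ<-toℕ; toℕ-fromℕ<; toℕ-injective)
open import Data.List.Base
  using (List; []; _∷_; [_]; _++_; map; concatMap; zip; length; replicate; applyUpTo; upTo)
open import Data.List.Membership.Propositional using (_∈_; lose)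
open import Data.List.Membership.Propositional.Properties using (∈-++⁺ʳ; ∈-map⁺; ∈-applyUpTo⁺)
open import Data.List.Properties
  using (length-++; length-map; length-applyUpTo; length-replicate; map-applyUpTo;
         concatMap-map; concatMap-pure; ++-identityʳ)
open import Data.List.Relation.Unary.Any using (Any; here; there; any?)
open import Data.Maybe.Base using (Maybe; just; nothing)
open import Data.Nat.Base
open import Data.Nat.Divisibility using (divides-refl)
open import Data.Nat.DivMod
open import Data.Nat.Induction using (<-wellFounded)
open import Data.Nat.ListAction using (sum)
open import Data.Nat.Logarithm
open import Data.Nat.Logarithm.Core using (⌈log2⌉)
open import Data.Nat.Properties
open import Data.Nat.Solver using (module +-*-Solver)
open import Data.Product.Base using (∃-syntax; _×_; _,_; proj₁; proj₂)
open import Data.Unit.Base using (⊤; tt)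
open import Function.Base using (_∘_)
open import Function.Bundles using (Equivalence)
open import Induction.WellFounded using (Acc; acc)
open import Relation.Binary.Definitions using (tri<; tri≈; tri>)
open import Relation.Binary.PropositionalEquality hiding ([_])
open import Relation.Nullary using (¬_; yes; no; contradiction)
open import Relation.Nullary.Reflects using (ofʸ; ofⁿ)
open import Relation.Unary using (Decidable)

open Obs

private variable
  A B I : Set
  o : Obs
  b : Bit

-- Computation steps

-- The observation `o` stays fixed along the whole sequence: computation takes no time, so neither
-- agent moves meanwhile.
data _⊢_↦*_ (o : Obs) : Prog A → Prog A → Set₁ where
  ε   : ∀ {p : Prog A} → o ⊢ p ↦* p
  _◅_ : ∀ {p q : Prog A} {f} → view p ≡ local f → o ⊢ f o ↦* q → o ⊢ p ↦* q

infixr 5 _◅_ _◅◅_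

_◅◅_ : ∀ {p q r : Prog A} → o ⊢ p ↦* q → o ⊢ q ↦* r → o ⊢ p ↦* r
ε        ◅◅ t = t
(eq ◅ s) ◅◅ t = eq ◅ (s ◅◅ t)

view->>=-local : ∀ {p : Prog A} {f} (k : A → Prog B) →
                 view p ≡ local f → view (p >>= k) ≡ local (λ o → f o >>= k)
view->>=-local k eq rewrite eq = refl

view->>=-moving : ∀ {p : Prog A} {q f} (k : A → Prog B) →
                  view p ≡ ready (moving q f) →
                  view (p >>= k) ≡ ready (moving q (λ x → f x >>= k))
view->>=-moving k eq rewrite eq = refl

>>=-↦* : ∀ {p q : Prog A} (k : A → Prog B) → o ⊢ p ↦* q → o ⊢ p >>= k ↦* (q >>= k)
>>=-↦* k ε        = ε
>>=-↦* k (_◅_ {p = p} eq s) = view->>=-local {p = p} k eq ◅ >>=-↦* k s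

data _⊢_⇓_ (o : Obs) (p : Prog A) (r : Ready A) : Set₁ where
  _,_ : ∀ {q} → o ⊢ p ↦* q → view q ≡ ready r → o ⊢ p ⇓ r

_◅⇓_ : ∀ {p p′ : Prog A} {r} → o ⊢ p ↦* p′ → o ⊢ p′ ⇓ r → o ⊢ p ⇓ r
s ◅⇓ (t , eq) = (s ◅◅ t) , eq

>>=-⇓ : ∀ {p : Prog A} {q f} (k : A → Prog B) →
        o ⊢ p ⇓ moving q f → o ⊢ p >>= k ⇓ moving q (λ x → f x >>= k)
>>=-⇓ k (_,_ {q} s eq) = >>=-↦* k s , view->>=-moving {p = q} k eq

if-true : ∀ {c} {p q r : Prog A} → c ≡ true → o ⊢ p ↦* r → o ⊢ (if c then p else q) ↦* r
if-true refl s = s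

if-false : ∀ {c} {p q : Prog A} {r} → c ≡ false → o ⊢ q ⇓ r → o ⊢ (if c then p else q) ⇓ r
if-false refl s = s

<⇒<ᵇ≡true : ∀ {m n} → m < n → (m <ᵇ n) ≡ true
<⇒<ᵇ≡true {m} {n} m<n with m <ᵇ n | <ᵇ-reflects-< m n
... | true  | _       = refl
... | false | ofⁿ m≮n = contradiction m<n m≮n

≥⇒<ᵇ≡false : ∀ {m n} → n ≤ m → (m <ᵇ n) ≡ false
≥⇒<ᵇ≡false {m} {n} n≤m with m <ᵇ n | <ᵇ-reflects-< m n
... | false | _       = refl
... | true  | ofʸ m<n = contradiction n≤m (<⇒≱ m<n)

-- Behaves o S E p qs: as long as the surroundings are as in o, program p
-- tries the ports in qs one after the other, two rounds each (port 0 stands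
-- for staying idle).  If a try decreases the distance then p continues
-- as S at the new node; after the last unsuccessful try it continues as E.
data Behaves (o : Obs) (S E : Prog A) : Prog A → List ℕ → Set₁ where
  ended : ∀ {p} → o ⊢ p ↦* E → Behaves o S E p []
  tries : ∀ {p q qs f} → o ⊢ p ⇓ moving q f →
    (∀ {x o′} → (q ≡ 0 → x ≡ 0) → distanceNow o′ < distanceNow o → o′ ⊢ f x ↦* S) →
    (∀ {x o′} → (q ≡ 0 → x ≡ 0) → distanceNow o ≤ distanceNow o′ →
      ∃[ g ] (o′ ⊢ f x ⇓ moving x g × ∀ y → Behaves o S E (g y) qs)) →
    Behaves o S E p (q ∷ qs)

private variable
  S E : Prog A
  qs  : List ℕ

↦*-Behaves : ∀ {p p′ : Prog A} → o ⊢ p ↦* p′ → Behaves o S E p′ qs → Behaves o S E p qs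
↦*-Behaves s (ended t)           = ended (s ◅◅ t)
↦*-Behaves s (tries t succ fail) = tries (s ◅⇓ t) succ fail

>>=-Behaves : ∀ {p : Prog A} (k : A → Prog B) →
              Behaves o S E p qs → Behaves o (S >>= k) (E >>= k) (p >>= k) qs
>>=-Behaves k (ended s) = ended (>>=-↦* k s)
>>=-Behaves k (tries t succ fail) = tries (>>=-⇓ k t)
  (λ q0 lt → >>=-↦* k (succ q0 lt))
  (λ q0 ge → let (_ , u , rest) = fail q0 ge in _ , >>=-⇓ k u , λ y → >>=-Behaves k (rest y))

Behaves-success : ∀ {S S′ E p : Prog A} → (∀ {o′} → distanceNow o′ < distanceNow o → o′ ⊢ S ↦* S′) →
                  Behaves o S E p qs → Behaves o S′ E p qs
Behaves-success s (ended t) = ended t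
Behaves-success s (tries t succ fail) = tries t
  (λ q0 lt → succ q0 lt ◅◅ s lt)
  (λ q0 ge → let (_ , u , rest) = fail q0 ge in _ , u , λ y → Behaves-success s (rest y))

Behaves-++ : ∀ {S E E′ p : Prog A} {qs qs′} → Behaves o S E′ p qs → Behaves o S E E′ qs′ →
             Behaves o S E p (qs ++ qs′)
Behaves-++ (ended s) next = ↦*-Behaves s next
Behaves-++ (tries t succ fail) next = tries t succ
  (λ q0 ge → let (_ , u , rest) = fail q0 ge in _ , u , λ y → Behaves-++ (rest y) next)

Behaves-end : ∀ {S E E′ p : Prog A} → o ⊢ E ↦* E′ → Behaves o S E p qs → Behaves o S E′ p qs
Behaves-end {qs = qs} s b =
  subst (Behaves _ _ _ _) (++-identityʳ qs) (Behaves-++ b (ended s))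

for-step : ∀ {is : List I} {i s body after qs} →
           Behaves o (return (just s)) (return nothing) (body i) qs →
           Behaves o (return s) (for is body after) (for {A = A} (i ∷ is) body after) qs
for-step h = Behaves-success (λ _ → refl ◅ ε) (Behaves-end (refl ◅ ε) (>>=-Behaves _ h))

for-Behaves : ∀ {s body after} (ports : I → List ℕ) (is : List I) →
              (∀ i → Behaves o (return (just s)) (return nothing) (body i) (ports i)) →
              Behaves o (return s) after (for {A = A} is body after) (concatMap ports is)
for-Behaves ports []       h = ended ε
for-Behaves ports (i ∷ is) h = Behaves-++ (for-step (h i)) (for-Behaves ports is h)

-- The ports tried by the procedures

testedPorts : ℕ → Bit → List ℕ
testedPorts δ b = map (λ i → i * toℕ b) (applyUpTo suc δ)

testPorts-Behaves : ∀ δ → Behaves o (return success) (return failure) (testPorts δ b)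
                              (testedPorts δ b)
testPorts-Behaves {o} {b} δ =
  subst (Behaves _ _ _ _) ports≡ (for-Behaves _ (applyUpTo suc δ) attempt-Behaves)
  where
  ports≡ : concatMap (λ i → [ i * toℕ b ]) (applyUpTo suc δ) ≡ testedPorts δ b
  ports≡ = trans (sym (concatMap-map [_] (λ i → i * toℕ b) (applyUpTo suc δ)))
                 (concatMap-pure (testedPorts δ b))

  -- `testPorts` goes back by `move (x * toℕ b)`, while `Behaves` asks for `moving x`. For a passive
  -- bit the try used port 0, which returns 0, so the two agree; this is what the premise
  -- `q ≡ 0 → x ≡ 0` provides.
  stays : ∀ (b : Bit) {i x} → (i * toℕ b ≡ 0 → x ≡ 0) → x * toℕ b ≡ x
  stays zero {i} {x} h = trans (*-zeroʳ x) (sym (h (*-zeroʳ i)))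
  stays (suc zero) {x = x} h = *-identityʳ x

  attempt-Behaves : ∀ i → Behaves o _ _ _ [ i * toℕ b ]
  attempt-Behaves i = tries ((refl ◅ refl ◅ ε) , refl)
    (λ _ lt → refl ◅ refl ◅ refl ◅ if-true (<⇒<ᵇ≡true lt) ε)
    (λ q0 ge → (λ y → return y >>= λ _ → return nothing) ,
               (refl ◅ refl ◅ refl ◅ ε) ◅⇓ if-false (≥⇒<ᵇ≡false ge)
                 (ε , cong (λ y → ready (moving y _)) (stays b {i} q0)) ,
               λ _ → ended (refl ◅ ε))

replicate-++ : ∀ m n (x : A) → replicate m x ++ replicate n x ≡ replicate (m + n) x
replicate-++ zero    n x = refl
replicate-++ (suc m) n x = cong (x ∷_) (replicate-++ m n x)

applyUpTo-const : ∀ (f : ℕ → A) {x} → (∀ i → f i ≡ x) → ∀ n → applyUpTo f n ≡ replicate n x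
applyUpTo-const f f≡x zero    = refl
applyUpTo-const f f≡x (suc n) = cong₂ _∷_ (f≡x 0) (applyUpTo-const (f ∘ suc) (λ i → f≡x (suc i)) n)

testedPorts-0b : ∀ δ → testedPorts δ 0b ≡ replicate δ 0
testedPorts-0b δ = trans (map-applyUpTo suc (_* 0) δ) (applyUpTo-const _ (λ i → *-zeroʳ (suc i)) δ)

waiting : ℕ → ℕ
waiting k = sum (map (2 ^_) (upTo k))

-- Stated for any doubling `f` rather than `2 ^_`, so that the induction can pass to `f ∘ suc` as
-- `applyUpTo` does.
sum-doubling : ∀ (f : ℕ → ℕ) → (∀ i → f (suc i) ≡ f i + f i) →
               ∀ n → f 0 + sum (applyUpTo f n) ≡ f n
sum-doubling f double zero    = +-identityʳ (f 0)
sum-doubling f double (suc n) = begin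
  f 0 + (f 0 + sum (applyUpTo (f ∘ suc) n)) ≡⟨ +-assoc (f 0) (f 0) _ ⟨
  f 0 + f 0 + sum (applyUpTo (f ∘ suc) n)   ≡⟨ cong (_+ sum (applyUpTo (f ∘ suc) n)) (double 0) ⟨
  f 1 + sum (applyUpTo (f ∘ suc) n)         ≡⟨ sum-doubling (f ∘ suc) (λ i → double (suc i)) n ⟩
  f (suc n)                                 ∎
  where open ≡-Reasoning

suc-waiting : ∀ k → suc (waiting k) ≡ 2 ^ k
suc-waiting k = trans (cong (suc ∘ sum) (map-applyUpTo (λ i → i) (2 ^_) k))
                      (sum-doubling (2 ^_) (λ i → cong (2 ^ i +_) (+-identityʳ (2 ^ i))) k)

boundPorts : ℕ → Bit → List ℕ
boundPorts k b = replicate (waiting k) 0 ++ testedPorts (2 ^ k) b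

boundPorts-0b : ∀ k → boundPorts k 0b ≡ replicate (waiting k + 2 ^ k) 0
boundPorts-0b k = trans (cong (replicate (waiting k) 0 ++_) (testedPorts-0b (2 ^ k)))
                        (replicate-++ (waiting k) (2 ^ k) 0)

length-boundPorts : ∀ k b → length (boundPorts k b) ≡ waiting k + 2 ^ k
length-boundPorts k b = begin
  length (boundPorts k b)
    ≡⟨ length-++ (replicate (waiting k) 0) ⟩
  length (replicate (waiting k) 0) + length (testedPorts (2 ^ k) b)
    ≡⟨ cong₂ _+_ (length-replicate (waiting k)) tested ⟩
  waiting k + 2 ^ k
    ∎
  where
  open ≡-Reasoning
  tested : length (testedPorts (2 ^ k) b) ≡ 2 ^ k
  tested = trans (length-map _ (applyUpTo suc (2 ^ k))) (length-applyUpTo suc (2 ^ k))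

exponent : Obs → ℕ
exponent o = ⌈log₂ degreeNow o ⌉

boundDegrees-Behaves : ∀ o b → Behaves o (return success) (return failure) (boundDegrees b)
                         (boundPorts (exponent o) b)
boundDegrees-Behaves o b = ↦*-Behaves (refl ◅ refl ◅ ε)
  (Behaves-++ (subst (Behaves _ _ _ _) (idle≡ (upTo (exponent o)))
                (for-Behaves _ (upTo (exponent o)) passive-Behaves))
              (testPorts-Behaves (2 ^ exponent o)))
  where
  idle≡ : ∀ is → concatMap (λ l → testedPorts (2 ^ l) 0b) is ≡ replicate (sum (map (2 ^_) is)) 0
  idle≡ []       = refl
  idle≡ (l ∷ is) = trans (cong₂ _++_ (testedPorts-0b (2 ^ l)) (idle≡ is)) (replicate-++ (2 ^ l) _ 0)

  passive-Behaves : ∀ l → Behaves o _ _ _ (testedPorts (2 ^ l) 0b)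
  passive-Behaves l = Behaves-success (λ _ → refl ◅ ε)
    (Behaves-end (refl ◅ ε) (>>=-Behaves _ (testPorts-Behaves (2 ^ l))))

-- rendezvous ℓ from the point where the bit b has been determined
final : Bit → Prog ⊤
final b = while (λ _ → apart) (λ _ → boundDegrees b >> return tt) tt

final-Behaves : ∀ o b → 0 < distanceNow o →
                Behaves o (final b) (final b) (final b) (boundPorts (exponent o) b)
-- Matching on a positive distance makes the loop test compute to `true`. The outcome of
-- `boundDegrees` is discarded, so both continuations are the loop itself.
final-Behaves o@(record { distanceNow = suc _ }) b _ = ↦*-Behaves (refl ◅ refl ◅ refl ◅ refl ◅ ε)
  (Behaves-success (λ _ → refl ◅ refl ◅ ε)
    (Behaves-end (refl ◅ refl ◅ ε)
      (>>=-Behaves _ (>>=-Behaves _ (boundDegrees-Behaves o b)))))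

bitLoop : (ℕ → Prog (Maybe (Maybe Bit))) → (Maybe Bit → Prog ⊤) → List ℕ → Prog ⊤
bitLoop body k is = for is body (return nothing) >>= k

-- A record because the loop bodies in rendezvous are local definitions,
-- which can be referred to only by unification.
record Structure (ℓ : ℕ) (p : Prog ⊤) : Set₁ where
  field
    body : ℕ → Prog (Maybe (Maybe Bit))
    rest : Maybe Bit → Prog ⊤

  comparing : List ℕ → Prog ⊤
  comparing = bitLoop body rest

  field
    searches : ∀ o → 0 < distanceNow o →
               Behaves o p (comparing (applyUpTo suc (bitLength (ξ ℓ)))) p (boundPorts (exponent o) 1b)
    compares : ∀ o i is →
               Behaves o (final (bit (ξ ℓ) i)) (comparing is) (comparing (i ∷ is))
                 (boundPorts (exponent o) (bit (ξ ℓ) i))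

-- The loop condition is local to `rendezvous`, so it is abstracted to `c`; only its two evaluations
-- at `o` matter. A success restarts the loop in its initial state.
while-Behaves : ∀ {c : Outcome → Prog Bool} (k : Outcome → Prog ⊤) →
  o ⊢ c failure ↦* return false → o ⊢ c success ↦* return true →
  let p = while c (λ _ → boundDegrees 1b) success >>= k in
  Behaves o p (k failure) p (boundPorts (exponent o) 1b)
while-Behaves k stop go = ↦*-Behaves
  (>>=-↦* k (refl ◅ (>>=-↦* _ go ◅◅ refl ◅ ε)))
  (Behaves-end (>>=-↦* k (refl ◅ refl ◅ >>=-↦* _ stop ◅◅ refl ◅ ε) ◅◅ refl ◅ ε)
    (Behaves-success (λ _ → >>=-↦* k (refl ◅ ε))
      (>>=-Behaves k (>>=-Behaves _ (boundDegrees-Behaves _ 1b)))))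

rendezvous-structure : ∀ ℓ → Structure ℓ (rendezvous ℓ)
rendezvous-structure ℓ = record
  { searches = λ { o@(record { distanceNow = suc _ }) _ →
      while-Behaves _ (refl ◅ refl ◅ refl ◅ ε) (refl ◅ refl ◅ refl ◅ ε) }
  ; compares = λ o i is → Behaves-success (λ _ → refl ◅ ε)
      (>>=-Behaves _ (for-step {i = i} (Behaves-success (λ _ → refl ◅ ε)
        (Behaves-end (refl ◅ ε) (>>=-Behaves _ (boundDegrees-Behaves o (bit (ξ ℓ) i)))))))
  }

-- Logarithms

n<2^[1+⌊log₂n⌋] : ∀ n → n < 2 ^ suc ⌊log₂ n ⌋
n<2^[1+⌊log₂n⌋] n = ≰⇒> λ 2^≤n →
  n≮n ⌊log₂ n ⌋ (subst (_≤ ⌊log₂ n ⌋) (⌊log₂[2^n]⌋≡n _) (⌊log₂⌋-mono-≤ 2^≤n))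

n≤2^⌈log₂n⌉ : ∀ n → n ≤ 2 ^ ⌈log₂ n ⌉
n≤2^⌈log₂n⌉ n = go n (<-wellFounded n)
  where
  n≤2⌈n/2⌉ : ∀ n → n ≤ 2 * ⌈ n /2⌉
  n≤2⌈n/2⌉ 0 = z≤n
  n≤2⌈n/2⌉ 1 = s≤s z≤n
  n≤2⌈n/2⌉ (suc (suc n)) = ≤-trans (s≤s (s≤s (n≤2⌈n/2⌉ n))) (≤-reflexive (sym (*-suc 2 ⌈ n /2⌉)))

  -- The accessibility proof is arbitrary because `⌈log2⌉` recurses on it.
  go : ∀ n (rec : Acc _<_ n) → n ≤ 2 ^ ⌈log2⌉ n rec
  go 0 _ = z≤n
  go 1 _ = ≤-refl
  go (suc (suc n)) (acc rs) = ≤-trans (n≤2⌈n/2⌉ (suc (suc n))) (*-monoʳ-≤ 2 (go (suc ⌈ n /2⌉) _))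

2^⌈log₂n⌉<2n : ∀ n .{{_ : NonZero n}} → 2 ^ ⌈log₂ n ⌉ < 2 * n
2^⌈log₂n⌉<2n n = ≰⇒> λ 2n≤2^ →
  n≮n ⌈log₂ n ⌉ (subst₂ _≤_ (⌈log₂2*n⌉≡1+⌈log₂n⌉ n) (⌈log₂2^n⌉≡n _) (⌈log₂⌉-mono-≤ 2n≤2^))

-- Bits

bit-first : ∀ n → toℕ (bit n 1) ≡ n % 2
bit-first n = trans (toℕ-fromℕ< (m%n<n (n / 1) 2)) (cong (_% 2) (n/1≡n n))

bit-suc : ∀ n j → bit n (suc (suc j)) ≡ bit (n / 2) (suc j)
bit-suc n j = cong (_mod 2) (sym (m/n/o≡m/[n*o] n 2 (2 ^ j)))
  where instance _ = m^n≢0 2 j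
                 _ = m^n≢0 2 (suc j)

[b+2m]%2≡b : ∀ (b : Bit) m → (toℕ b + m * 2) % 2 ≡ toℕ b
[b+2m]%2≡b b m = trans ([m+kn]%n≡m%n (toℕ b) m 2) (m<n⇒m%n≡m (toℕ<n b))

[b+2m]/2≡m : ∀ (b : Bit) m → (toℕ b + m * 2) / 2 ≡ m
[b+2m]/2≡m b m = begin
  (toℕ b + m * 2) / 2   ≡⟨ +-distrib-/-∣ʳ (toℕ b) (divides-refl m) ⟩
  toℕ b / 2 + m * 2 / 2 ≡⟨ cong₂ _+_ (m<n⇒m/n≡0 (toℕ<n b)) (m*n/n≡m m 2) ⟩
  m                     ∎
  where open ≡-Reasoning

bit-fromDigits : ∀ (g : ℕ → Bit) {n j} → j < n → bit (fromDigits (applyUpTo g n)) (suc j) ≡ g j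
bit-fromDigits g {suc n} {zero}  _ =
  toℕ-injective (trans (bit-first (toℕ (g 0) + m * 2)) ([b+2m]%2≡b (g 0) m))
  where m = fromDigits (applyUpTo (g ∘ suc) n)
bit-fromDigits g {suc n} {suc j} (s<s j<n) = begin
  bit (toℕ (g 0) + m * 2) (suc (suc j))   ≡⟨ bit-suc (toℕ (g 0) + m * 2) j ⟩
  bit ((toℕ (g 0) + m * 2) / 2) (suc j)   ≡⟨ cong (λ k → bit k (suc j)) ([b+2m]/2≡m (g 0) m) ⟩
  bit m (suc j)                           ≡⟨ bit-fromDigits (g ∘ suc) j<n ⟩
  g (suc j)                               ∎
  where
  open ≡-Reasoning
  m = fromDigits (applyUpTo (g ∘ suc) n)

2^n≤fromDigits : ∀ (g : ℕ → Bit) n → g n ≡ 1b → 2 ^ n ≤ fromDigits (applyUpTo g (suc n))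
2^n≤fromDigits g zero    g≡1 rewrite g≡1 = ≤-refl
2^n≤fromDigits g (suc n) g≡1 = begin
  2 * 2 ^ n       ≡⟨ *-comm 2 (2 ^ n) ⟩
  2 ^ n * 2       ≤⟨ *-monoˡ-≤ 2 (2^n≤fromDigits (g ∘ suc) n g≡1) ⟩
  m * 2           ≤⟨ m≤n+m (m * 2) (toℕ (g 0)) ⟩
  toℕ (g 0) + m * 2 ∎
  where
  open ≤-Reasoning
  m = fromDigits (applyUpTo (g ∘ suc) (suc n))

-- If the parities differ, the lowest bit separates the numbers; otherwise their halves differ and
-- fit in one bit less.
differing-bit : ∀ n {k l} → k < 2 ^ n → l < 2 ^ n → k ≢ l →
                ∃[ j ] (j < n × bit k (suc j) ≢ bit l (suc j))
differing-bit zero    (s≤s z≤n) (s≤s z≤n) k≢l = contradiction refl k≢l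
differing-bit (suc n) {k} {l} k<2^ l<2^ k≢l with k % 2 ≟ l % 2
... | no  k≢ₘl = 0 , z<s , λ eq →
  k≢ₘl (trans (sym (bit-first k)) (trans (cong toℕ eq) (bit-first l)))
... | yes k≡ₘl =
  let j , j<n , bits≢ = differing-bit n (half< k<2^) (half< l<2^) half≢
  in suc j , s<s j<n , λ eq → bits≢ (trans (sym (bit-suc k j)) (trans eq (bit-suc l j)))
  where
  half< : ∀ {m} → m < 2 ^ suc n → m / 2 < 2 ^ n
  half< {m} m<2^ = m<n*o⇒m/o<n (subst (m <_) (*-comm 2 (2 ^ n)) m<2^)

  half≢ : k / 2 ≢ l / 2
  half≢ eq = k≢l (trans (m≡m%n+[m/n]*n k 2)
    (trans (cong₂ (λ r q → r + q * 2) k≡ₘl eq) (sym (m≡m%n+[m/n]*n l 2))))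

-- Extended labels

≡ᵇ-refl : ∀ n → (n ≡ᵇ n) ≡ true
≡ᵇ-refl n = Equivalence.to T-≡ (≡⇒≡ᵇ n n refl)

≢⇒≡ᵇ≡false : ∀ {m n} → m ≢ n → (m ≡ᵇ n) ≡ false
≢⇒≡ᵇ≡false {m} {n} m≢n with m ≡ᵇ n in eq
... | false = refl
... | true  = contradiction (≡ᵇ⇒≡ m n (Equivalence.from T-≡ eq)) m≢n

ξ-bit-even : ∀ ℓ k → ξ-bit ℓ (2 * k) ≡ (if 2 * k ≡ᵇ 2 * bitLength ℓ then 1b else 0b)
ξ-bit-even ℓ k rewrite trans (cong (_% 2) (*-comm 2 k)) (m*n%n≡0 k 2) = refl

ξ-bit-last : ∀ ℓ → ξ-bit ℓ (2 * bitLength ℓ) ≡ 1b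
ξ-bit-last ℓ = trans (ξ-bit-even ℓ (bitLength ℓ))
  (cong (if_then 1b else 0b) (≡ᵇ-refl (2 * bitLength ℓ)))

ξ-bit-interior : ∀ ℓ {k} → k < bitLength ℓ → ξ-bit ℓ (2 * k) ≡ 0b
ξ-bit-interior ℓ {k} k< = trans (ξ-bit-even ℓ k)
  (cong (if_then 1b else 0b) (≢⇒≡ᵇ≡false (<⇒≢ (*-monoʳ-< 2 k<))))

ξ-bit-odd : ∀ ℓ {j} → j < bitLength ℓ → ξ-bit ℓ (suc (2 * j)) ≡ bit ℓ (suc j)
ξ-bit-odd ℓ {j} j<
  rewrite trans (cong (λ m → suc m % 2) (*-comm 2 j)) ([m+kn]%n≡m%n 1 j 2)
        | Equivalence.to T-≡ (≤⇒≤ᵇ (∸-monoˡ-≤ 1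
            (subst (_≤ 2 * bitLength ℓ) (*-suc 2 j) (*-monoʳ-≤ 2 j<))))
  = cong (bit ℓ ∘ suc) (⌊2n/2⌋≡n j)
  where
  ⌊2n/2⌋≡n : ∀ n → ⌊ 2 * n /2⌋ ≡ n
  ⌊2n/2⌋≡n zero    = refl
  ⌊2n/2⌋≡n (suc n) = trans (cong ⌊_/2⌋ (*-suc 2 n)) (cong suc (⌊2n/2⌋≡n n))

bit-ξ : ∀ ℓ {j} → j < 2 * bitLength ℓ → bit (ξ ℓ) (suc j) ≡ ξ-bit ℓ (suc j)
bit-ξ ℓ = bit-fromDigits (ξ-bit ℓ ∘ suc)

-- The terminating bit is 1, so `ξ ℓ` has no fewer digits than intended. Hence the loop of
-- `compareLabels` reaches every differing position found below.
2*bitLength≤bitLength-ξ : ∀ ℓ → 2 * bitLength ℓ ≤ bitLength (ξ ℓ)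
2*bitLength≤bitLength-ξ ℓ = s≤s (≤-trans (≤-reflexive (sym (⌊log₂[2^n]⌋≡n n)))
  (⌊log₂⌋-mono-≤ (2^n≤fromDigits (ξ-bit ℓ ∘ suc) n (ξ-bit-last ℓ))))
  where n = 2 * bitLength ℓ ∸ 1

-- Positions count from 0. Requiring `j` to lie below both lengths is what yields the minimum over
-- the two labels in the time bound.
DifferingPosition : (ℕ → ℕ → Bit) → ℕ → ℕ → Set
DifferingPosition digit k l =
  ∃[ j ] (j < 2 * bitLength k × j < 2 * bitLength l × digit k (suc j) ≢ digit l (suc j))

-- The terminating 1 of the shorter label faces an interior even position of the longer one, which
-- holds 0.
shorter⇒differing : ∀ {k l} → bitLength k < bitLength l → DifferingPosition ξ-bit k l
shorter⇒differing {k} {l} k<l =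
  2 * bitLength k ∸ 1 , ≤-refl , *-monoʳ-≤ 2 (<⇒≤ k<l) ,
  λ eq → 1b≢0b (trans (sym (ξ-bit-last k)) (trans eq (ξ-bit-interior l k<l)))
  where
  1b≢0b : 1b ≢ 0b
  1b≢0b ()

differing-ξ-bit : ∀ {k l} → k ≢ l → DifferingPosition ξ-bit k l
differing-ξ-bit {k} {l} k≢l with <-cmp (bitLength k) (bitLength l)
... | tri< k<l _ _ = shorter⇒differing {k} {l} k<l
... | tri> _ _ l<k =
  let j , j<l , j<k , bits≢ = shorter⇒differing {l} {k} l<k in j , j<k , j<l , ≢-sym bits≢
... | tri≈ _ k≈l _ =
  let j , j<l , bits≢ = differing-bit (bitLength l)
        (subst (λ n → k < 2 ^ n) k≈l (n<2^[1+⌊log₂n⌋] k)) (n<2^[1+⌊log₂n⌋] l) k≢l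
      j<k = subst (j <_) (sym k≈l) j<l
  -- Bit `suc j` of a label stands at the odd position `suc (2 * j)` of its extension.
  in 2 * j , *-monoʳ-< 2 j<k , *-monoʳ-< 2 j<l ,
     λ eq → bits≢ (trans (sym (ξ-bit-odd k j<k)) (trans eq (ξ-bit-odd l j<l)))

differing-bit-ξ : ∀ {k l} → k ≢ l → DifferingPosition (bit ∘ ξ) k l
differing-bit-ξ {k} {l} k≢l =
  let j , j<k , j<l , bits≢ = differing-ξ-bit k≢l
  in j , j<k , j<l , λ eq → bits≢ (trans (sym (bit-ξ k j<k)) (trans eq (bit-ξ l j<l)))

-- Two agents

-- Every port tried by one agent is paired with an idle try of the other, provided that the latter
-- idles long enough.
∈-zip-replicate : ∀ {A B : Set} {x : A} {y : B} {xs ys m} → x ∈ xs → length xs ≤ m →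
                  (x , y) ∈ zip xs (replicate m y ++ ys)
∈-zip-replicate (here refl) (s≤s _) = here refl
∈-zip-replicate (there x∈) (s≤s ≤m) = there (∈-zip-replicate x∈ ≤m)

-- Increased by 1, the two sides become `2 ^ suc k` and `2 ^ l`. So the agent with the smaller
-- exponent completes all its tries while the other still waits.
boundPorts-length≤waiting : ∀ {k l} → k < l → waiting k + 2 ^ k ≤ waiting l
boundPorts-length≤waiting {k} {l} k<l = s≤s⁻¹ (begin
  suc (waiting k) + 2 ^ k ≡⟨ cong₂ _+_ (suc-waiting k) (sym (+-identityʳ (2 ^ k))) ⟩
  2 ^ suc k               ≤⟨ ^-monoʳ-≤ 2 k<l ⟩
  2 ^ l                   ≡⟨ suc-waiting l ⟨
  suc (waiting l)         ∎)
  where open ≤-Reasoning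

-- The summands pay for the search, the common failure, the label comparison and the final chase.
-- This is at most `2D + 2m + 3` phases; as `D ≥ 1`, that is at most `5(D + m)`, and `5 · 8 = 40`.
total-rounds : ∀ Δ D m {j} → 0 < D → j ≤ 2 * suc m →
  let phase = 8 * Δ in
  D * phase + (phase + (j * phase + D * phase)) ≤ 40 * (Δ * (D + m))
total-rounds Δ D m {j} 0<D j≤ = begin
  D * β + (β + (j * β + D * β))         ≤⟨ +-monoʳ-≤ (D * β) (+-monoʳ-≤ β (+-monoˡ-≤ (D * β) j*β≤)) ⟩
  D * β + (β + (2 * suc m * β + D * β)) ≡⟨ expand ⟩
  3 * β + (2 * D * β + 2 * m * β)       ≤⟨ +-mono-≤ 3*β≤ (+-monoʳ-≤ (2 * D * β) 2*m*β≤) ⟩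
  3 * D * β + (2 * D * β + 5 * m * β)   ≡⟨ collect ⟩
  40 * (Δ * (D + m))                    ∎
  where
  open ≤-Reasoning
  open +-*-Solver
  β = 8 * Δ
  j*β≤ : j * β ≤ 2 * suc m * β
  j*β≤ = *-monoˡ-≤ β j≤
  3*β≤ : 3 * β ≤ 3 * D * β
  3*β≤ = *-monoˡ-≤ β (*-monoʳ-≤ 3 0<D)
  2*m*β≤ : 2 * m * β ≤ 5 * m * β
  2*m*β≤ = *-monoˡ-≤ β (*-monoˡ-≤ m (m≤m+n 2 3))
  expand = solve 3 (λ d m δ → let β = con 8 :* δ in
    d :* β :+ (β :+ (con 2 :* (con 1 :+ m) :* β :+ d :* β))
      := con 3 :* β :+ (con 2 :* d :* β :+ con 2 :* m :* β)) refl D m Δ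
  collect = solve 3 (λ d m δ → let β = con 8 :* δ in
    con 3 :* d :* β :+ (con 2 :* d :* β :+ con 5 :* m :* β)
      := con 40 :* (δ :* (d :+ m))) refl D m Δ

module TwoAgents (G : Graph) (P : PortLabelling G) (dist : Graph.V G → Graph.V G → ℕ)
                 (isDistance : IsDistance G dist) where
  open Graph G
  open PortLabelling P
  open IsDistance isDistance
  open Execution G P dist

  -- Unlike iteration of `step`, this predicate counts only rounds and hides the interleaving of
  -- computation steps, so that bounds for successive stages simply add.
  data Meets : ℕ → Agent → Agent → Set₁ where
    met  : ∀ {n a₁ a₂} → position a₁ ≡ position a₂ → Meets n a₁ a₂
    next : ∀ {n p₁ p₂ u₁ u₂ r₁ r₂} →
           observe u₁ u₂ ⊢ p₁ ⇓ r₁ → observe u₂ u₁ ⊢ p₂ ⇓ r₂ →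
           Meets n (act r₁ u₁) (act r₂ u₂) → Meets (suc n) (p₁ at u₁) (p₂ at u₂)

  config : Agent → Agent → ℕ → Config
  config a₁ a₂ r = record { agent₁ = a₁ ; agent₂ = a₂ ; round = r }

  after-step : ∀ {T c c′} → step c ≡ c′ → RendezvousWithin T c′ → RendezvousWithin T c
  after-step refl (n , same , r≤T) = suc n , same , r≤T

  step-local₁ : ∀ {p₁ p₂ u₁ u₂ r f} → view p₁ ≡ local f →
    step (config (p₁ at u₁) (p₂ at u₂) r) ≡ config (f (observe u₁ u₂) at u₁) (p₂ at u₂) r
  step-local₁ eq rewrite eq = refl

  step-local₂ : ∀ {p₁ p₂ u₁ u₂ r r₁ f} → view p₁ ≡ ready r₁ → view p₂ ≡ local f →
    step (config (p₁ at u₁) (p₂ at u₂) r) ≡ config (p₁ at u₁) (f (observe u₂ u₁) at u₂) r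
  step-local₂ eq₁ eq₂ rewrite eq₁ | eq₂ = refl

  step-round : ∀ {p₁ p₂ u₁ u₂ r r₁ r₂} → view p₁ ≡ ready r₁ → view p₂ ≡ ready r₂ →
    step (config (p₁ at u₁) (p₂ at u₂) r) ≡ config (act r₁ u₁) (act r₂ u₂) (suc r)
  step-round eq₁ eq₂ rewrite eq₁ | eq₂ = refl

  -- The recursion follows the scheduling of `step`: first the computation of agent 1, then that of
  -- agent 2, then the joint round.
  after-round : ∀ {T p₁ p₂ u₁ u₂ r r₁ r₂} →
    observe u₁ u₂ ⊢ p₁ ⇓ r₁ → observe u₂ u₁ ⊢ p₂ ⇓ r₂ →
    RendezvousWithin T (config (act r₁ u₁) (act r₂ u₂) (suc r)) →
    RendezvousWithin T (config (p₁ at u₁) (p₂ at u₂) r)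
  after-round {p₁ = p₁} {p₂} ((eq ◅ s₁) , eq₁) ready₂ w =
    after-step (step-local₁ {p₁} {p₂} eq) (after-round (s₁ , eq₁) ready₂ w)
  after-round {p₁ = p₁} {p₂} (ε , eq₁) ((eq ◅ s₂) , eq₂) w =
    after-step (step-local₂ {p₁} {p₂} eq₁ eq) (after-round (ε , eq₁) (s₂ , eq₂) w)
  after-round {p₁ = p₁} {p₂} (ε , eq₁) (ε , eq₂) w =
    after-step (step-round {p₁} {p₂} eq₁ eq₂) w

  Meets⇒RendezvousWithin : ∀ {n a₁ a₂ r} → Meets n a₁ a₂ → RendezvousWithin (n + r) (config a₁ a₂ r)
  Meets⇒RendezvousWithin {n} {r = r} (met same) = 0 , same , m≤n+m r n
  Meets⇒RendezvousWithin {suc n} {r = r} (next {u₁ = u₁} {u₂} {r₁} {r₂} ready₁ ready₂ m) =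
    after-round ready₁ ready₂
      (subst (λ T → RendezvousWithin T (config (act r₁ u₁) (act r₂ u₂) (suc r))) (+-suc n r)
        (Meets⇒RendezvousWithin {r = suc r} m))

  Meets-mono : ∀ {m n a₁ a₂} → m ≤ n → Meets m a₁ a₂ → Meets n a₁ a₂
  Meets-mono m≤n       (met same)             = met same
  Meets-mono (s≤s m≤n) (next ready₁ ready₂ m) = next ready₁ ready₂ (Meets-mono m≤n m)

  Meets-sym : ∀ {n a₁ a₂} → Meets n a₁ a₂ → Meets n a₂ a₁
  Meets-sym (met same)             = met (sym same)
  Meets-sym (next ready₁ ready₂ m) = next ready₂ ready₁ (Meets-sym m)

  ↦*-Meets : ∀ {n p₁ p₂ q₁ q₂ u₁ u₂} → observe u₁ u₂ ⊢ p₁ ↦* q₁ → observe u₂ u₁ ⊢ p₂ ↦* q₂ →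
             Meets n (q₁ at u₁) (q₂ at u₂) → Meets n (p₁ at u₁) (p₂ at u₂)
  ↦*-Meets s₁ s₂ (met same)             = met same
  ↦*-Meets s₁ s₂ (next ready₁ ready₂ m) = next (s₁ ◅⇓ ready₁) (s₂ ◅⇓ ready₂) m

  -- Distances and moves through ports

  snoc : ∀ {n u v w} → Walk _~_ n u v → v ~ w → Walk _~_ (suc n) u w
  snoc []      e = e ∷ []
  snoc (f ∷ p) e = f ∷ snoc p e

  reverse : ∀ {n u v} → Walk _~_ n u v → Walk _~_ n v u
  reverse []      = []
  reverse (e ∷ p) = snoc (reverse p) (~-sym e)

  dist-sym : ∀ u v → dist u v ≡ dist v u
  dist-sym u v = ≤-antisym (shortest (reverse (attained v u))) (shortest (reverse (attained u v)))

  dist≡0⇒≡ : ∀ {u v} → dist u v ≡ 0 → u ≡ v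
  dist≡0⇒≡ {u} {v} eq with dist u v | attained u v
  dist≡0⇒≡ refl | 0 | [] = refl

  target : V → ℕ → V
  target u q = proj₁ (moveFrom u q)

  entry : V → ℕ → ℕ
  entry u q = proj₂ (moveFrom u q)

  target-port : ∀ u (p : Fin (deg u)) → target u (suc (toℕ p)) ≡ nbr u p
  target-port u p with toℕ p <? deg u
  ... | yes p< = cong (nbr u) (fromℕ<-toℕ p p<)
  ... | no  p≮ = contradiction (toℕ<n p) p≮

  -- This includes port 0 and numbers beyond the degree: such a move stays put and returns 0, and
  -- `move 0` stays put again.
  target-entry : ∀ u q → target (target u q) (entry u q) ≡ u
  target-entry u zero = refl
  target-entry u (suc q) with q <? deg u
  ... | yes q< = trans (target-port _ _) (nbr-port _)
  ... | no  _  = refl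

  entry-0 : ∀ u {q} → q ≡ 0 → entry u q ≡ 0
  entry-0 u refl = refl

  -- The first edge of a shortest walk leads closer.
  closer-port : ∀ u v → 0 < dist u v → ∃[ p ] dist (target u (suc (toℕ {deg u} p))) v < dist u v
  closer-port u v 0<d with dist u v | attained u v
  ... | suc n | e ∷ walk = port e ,
    s≤s (subst (λ w → dist w v ≤ n) (sym (trans (target-port u (port e)) (nbr-port e)))
          (shortest walk))

  -- Simultaneous tries of the two agents

  Decreasing : V → V → ℕ × ℕ → Set
  Decreasing u₁ u₂ (q₁ , q₂) = dist (target u₁ q₁) (target u₂ q₂) < dist u₁ u₂

  -- By `dist-sym` one comparison of distances decides the branch of both agents. A success uses one
  -- of the two rounds; a failure uses both and restores the positions.
  try-both : ∀ {u₁ u₂ n S₁ E₁ S₂ E₂ p₁ p₂ q₁ q₂ qs₁ qs₂} →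
    Behaves (observe u₁ u₂) S₁ E₁ p₁ (q₁ ∷ qs₁) → Behaves (observe u₂ u₁) S₂ E₂ p₂ (q₂ ∷ qs₂) →
    (Decreasing u₁ u₂ (q₁ , q₂) → Meets n (S₁ at target u₁ q₁) (S₂ at target u₂ q₂)) →
    (∀ {p₁ p₂} → ¬ Decreasing u₁ u₂ (q₁ , q₂) →
      Behaves (observe u₁ u₂) S₁ E₁ p₁ qs₁ → Behaves (observe u₂ u₁) S₂ E₂ p₂ qs₂ →
      Meets n (p₁ at u₁) (p₂ at u₂)) →
    Meets (2 + n) (p₁ at u₁) (p₂ at u₂)
  try-both {u₁} {u₂} {n} {q₁ = q₁} {q₂} (tries t₁ succ₁ fail₁) (tries t₂ succ₂ fail₂)
    decreased not-decreased
    with dist (target u₁ q₁) (target u₂ q₂) <? dist u₁ u₂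
  ... | yes d = next t₁ t₂ (Meets-mono (n≤1+n n)
    (↦*-Meets (succ₁ (entry-0 u₁) d)
      (succ₂ (entry-0 u₂) (subst₂ _<_ (dist-sym _ _) (dist-sym _ _) d))
      (decreased d)))
  ... | no ¬d =
    let g₁ , s₁ , rest₁ = fail₁ (entry-0 u₁) (≮⇒≥ ¬d)
        g₂ , s₂ , rest₂ = fail₂ (entry-0 u₂) (subst₂ _≤_ (dist-sym _ _) (dist-sym _ _) (≮⇒≥ ¬d))
        y₁ = entry (target u₁ q₁) (entry u₁ q₁)
        y₂ = entry (target u₂ q₂) (entry u₂ q₂)
    in next t₁ t₂ (next s₁ s₂
         (subst₂ (λ v₁ v₂ → Meets n (g₁ y₁ at v₁) (g₂ y₂ at v₂))
           (sym (target-entry u₁ q₁)) (sym (target-entry u₂ q₂))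
           (not-decreased ¬d (rest₁ y₁) (rest₂ y₂))))

  -- Unsuccessful pairs are undone, so a decreasing pair further down the lists remains decreasing
  -- until it is reached.
  duel-success : ∀ {u₁ u₂ n S₁ E₁ S₂ E₂ p₁ p₂ qs₁ qs₂} →
    Behaves (observe u₁ u₂) S₁ E₁ p₁ qs₁ → Behaves (observe u₂ u₁) S₂ E₂ p₂ qs₂ →
    Any (Decreasing u₁ u₂) (zip qs₁ qs₂) →
    (∀ {w₁ w₂} → dist w₁ w₂ < dist u₁ u₂ → Meets n (S₁ at w₁) (S₂ at w₂)) →
    Meets (length qs₁ * 2 + n) (p₁ at u₁) (p₂ at u₂)
  duel-success {n = n} {qs₁ = _ ∷ qs₁} {_ ∷ _} b₁ b₂ any onward =
    try-both b₁ b₂ (λ d → Meets-mono (m≤n+m n (length qs₁ * 2)) (onward d))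
      λ ¬d b₁ b₂ → duel-success b₁ b₂ (tail ¬d any) onward
    where
    tail : ∀ {q qs} → ¬ Decreasing _ _ q → Any (Decreasing _ _) (q ∷ qs) → Any (Decreasing _ _) qs
    tail ¬d (here d)    = contradiction d ¬d
    tail ¬d (there any) = any
  duel-success {qs₁ = []}    _ _ ()
  duel-success {qs₁ = _ ∷ _} {[]} _ _ ()

  -- Equal lengths make both programs reach their ends in the same round.
  duel-failure : ∀ {u₁ u₂ n S₁ E₁ S₂ E₂ p₁ p₂ qs₁ qs₂} →
    Behaves (observe u₁ u₂) S₁ E₁ p₁ qs₁ → Behaves (observe u₂ u₁) S₂ E₂ p₂ qs₂ →
    length qs₁ ≡ length qs₂ → ¬ Any (Decreasing u₁ u₂) (zip qs₁ qs₂) →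
    Meets n (E₁ at u₁) (E₂ at u₂) → Meets (length qs₁ * 2 + n) (p₁ at u₁) (p₂ at u₂)
  duel-failure (ended s₁) (ended s₂) _ _ end = ↦*-Meets s₁ s₂ end
  duel-failure b₁@(tries _ _ _) b₂@(tries _ _ _) eq none end =
    try-both b₁ b₂ (λ d → contradiction (here d) none)
      λ _ b₁ b₂ → duel-failure b₁ b₂ (suc-injective eq) (none ∘ there) end

  decreasing? : ∀ u₁ u₂ → Decidable (Decreasing u₁ u₂)
  decreasing? u₁ u₂ (q₁ , q₂) = dist (target u₁ q₁) (target u₂ q₂) <? dist u₁ u₂

  -- Round bounds for the stages of the procedure

  module _ {Δ} (deg≤Δ : ∀ v → deg v ≤ Δ) where

    class : V → ℕ
    class u = ⌈log₂ deg u ⌉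

    phase : ℕ
    phase = 8 * Δ

    -- Two rounds per try, fewer than `2 * 2 ^ k` tries, and `2 ^ k < 2 * deg u` give the factor 8.
    -- The last estimate fails at degree 0, which the positive distance excludes.
    boundPorts-rounds : ∀ {u v b} → 0 < dist u v → length (boundPorts (class u) b) * 2 ≤ phase
    boundPorts-rounds {u} {v} {b} 0<d = begin
      length (boundPorts k b) * 2 ≡⟨ cong (_* 2) (length-boundPorts k b) ⟩
      (waiting k + 2 ^ k) * 2     ≤⟨ *-monoˡ-≤ 2 (+-monoˡ-≤ (2 ^ k) waiting≤2^k) ⟩
      (2 ^ k + 2 ^ k) * 2         ≤⟨ *-monoˡ-≤ 2 (+-mono-≤ 2^k≤2Δ 2^k≤2Δ) ⟩
      (2 * Δ + 2 * Δ) * 2         ≡⟨ solve 1 (λ x → (con 2 :* x :+ con 2 :* x) :* con 2 := con 8 :* x)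
                                             refl Δ ⟩
      phase                       ∎
      where
      open ≤-Reasoning
      open +-*-Solver
      k = class u
      instance
        _ : NonZero (deg u)
        _ = >-nonZero (≤-<-trans z≤n (toℕ<n (proj₁ (closer-port u v 0<d))))
      waiting≤2^k : waiting k ≤ 2 ^ k
      waiting≤2^k = ≤-trans (n≤1+n _) (≤-reflexive (suc-waiting k))
      2^k≤2Δ : 2 ^ k ≤ 2 * Δ
      2^k≤2Δ = ≤-trans (<⇒≤ (2^⌈log₂n⌉<2n (deg u))) (*-monoʳ-≤ 2 (deg≤Δ u))

    closer∈boundPorts : ∀ u v → 0 < dist u v →
                        ∃[ q ] (q ∈ boundPorts (class u) 1b × dist (target u q) v < dist u v)
    closer∈boundPorts u v 0<d =
      let p , closer = closer-port u v 0<d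
          i∈ = ∈-map⁺ (_* 1) (∈-applyUpTo⁺ suc (<-≤-trans (toℕ<n p) (n≤2^⌈log₂n⌉ (deg u))))
      in suc (toℕ p) ,
         ∈-++⁺ʳ (replicate (waiting (class u)) 0)
           (subst (_∈ testedPorts (2 ^ class u) 1b) (*-identityʳ _) i∈) ,
         closer

    -- The active agent tests a port that leads closer while the other stays put. The arbitrary
    -- `rest` lets this serve both an agent that becomes active later and one that is passive
    -- throughout.
    active-idle : ∀ {u₁ u₂ n m rest S₁ E₁ S₂ E₂ p₁ p₂} → 0 < dist u₁ u₂ →
      Behaves (observe u₁ u₂) S₁ E₁ p₁ (boundPorts (class u₁) 1b) →
      Behaves (observe u₂ u₁) S₂ E₂ p₂ (replicate m 0 ++ rest) →
      waiting (class u₁) + 2 ^ class u₁ ≤ m →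
      (∀ {w₁ w₂} → dist w₁ w₂ < dist u₁ u₂ → Meets n (S₁ at w₁) (S₂ at w₂)) →
      Meets (phase + n) (p₁ at u₁) (p₂ at u₂)
    active-idle {u₁} {u₂} {n} {m} 0<d b₁ b₂ long onward =
      let q , q∈ , closer = closer∈boundPorts u₁ u₂ 0<d
          short = subst (_≤ m) (sym (length-boundPorts (class u₁) 1b)) long
      in Meets-mono (+-monoˡ-≤ n (boundPorts-rounds {b = 1b} 0<d))
           (duel-success b₁ b₂
             (lose (∈-zip-replicate q∈ short) closer)
             onward)

    -- In the chase the exponents may differ, so one passive call can be shorter than the active
    -- one; hence several calls are chained.
    final-idle : ∀ m {o} → 0 < distanceNow o →
      Behaves o (final 0b) (final 0b) (final 0b)
        (replicate (m * (waiting (exponent o) + 2 ^ exponent o)) 0)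
    final-idle zero        0<d = ended ε
    final-idle (suc m) {o} 0<d = subst (Behaves _ _ _ _) (replicate-++ (waiting k + 2 ^ k) _ 0)
      (Behaves-++ (subst (Behaves _ _ _ _) (boundPorts-0b k) (final-Behaves o 0b 0<d))
        (final-idle m 0<d))
      where k = exponent o

    chase : ∀ d {u₁ u₂} → dist u₁ u₂ ≤ d → Meets (d * phase) (final 1b at u₁) (final 0b at u₂)
    chase d {u₁} {u₂} ≤d with dist u₁ u₂ ≟ 0
    ... | yes ≡0 = met (dist≡0⇒≡ ≡0)
    chase zero    ≤d | no ≢0 = contradiction (n≤0⇒n≡0 ≤d) ≢0
    chase (suc d) {u₁} {u₂} ≤d | no ≢0 = active-idle 0<d
      (final-Behaves _ 1b 0<d)
      (subst (Behaves _ _ _ _) (sym (++-identityʳ _))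
        (final-idle m (subst (0 <_) (dist-sym u₁ u₂) 0<d)))
      -- `m` passive calls, each of at least one idle try, outlast the `m` tries of the active
      -- agent.
      (m≤m*n m _)
      (λ closer → chase d (s≤s⁻¹ (<-≤-trans closer ≤d)))
      where
      0<d = n≢0⇒n>0 ≢0
      m = waiting (class u₁) + 2 ^ class u₁
      instance
        _ : NonZero (waiting (class u₂) + 2 ^ class u₂)
        _ = >-nonZero (<-≤-trans (m^n>0 2 (class u₂)) (m≤n+m _ (waiting (class u₂))))

    final-differing : ∀ {d b₁ b₂ u₁ u₂} → b₁ ≢ b₂ → dist u₁ u₂ ≤ d →
                      Meets (d * phase) (final b₁ at u₁) (final b₂ at u₂)
    final-differing {b₁ = zero}     {zero}     b≢ _  = contradiction refl b≢
    final-differing {b₁ = suc zero} {suc zero} b≢ _  = contradiction refl b≢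
    final-differing {b₁ = suc zero} {zero}     _  ≤d = chase _ ≤d
    final-differing {b₁ = zero}     {suc zero} _  ≤d =
      Meets-sym (chase _ (≤-trans (≤-reflexive (dist-sym _ _)) ≤d))

    -- One agent is passive, and equal exponents make it idle for exactly as many tries as the
    -- active one makes. The success then sends each agent to `final` with its own bit.
    boundDegrees-differing : ∀ {b₁ b₂ u₁ u₂ C₁ C₂ p₁ p₂} →
      0 < dist u₁ u₂ → class u₁ ≡ class u₂ → b₁ ≢ b₂ →
      Behaves (observe u₁ u₂) (final b₁) C₁ p₁ (boundPorts (class u₁) b₁) →
      Behaves (observe u₂ u₁) (final b₂) C₂ p₂ (boundPorts (class u₂) b₂) →
      Meets (phase + dist u₁ u₂ * phase) (p₁ at u₁) (p₂ at u₂)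
    boundDegrees-differing {zero}     {zero}     _ _ b≢ _ _ = contradiction refl b≢
    boundDegrees-differing {suc zero} {suc zero} _ _ b≢ _ _ = contradiction refl b≢
    boundDegrees-differing {suc zero} {zero} {u₁} {u₂} 0<d k≡ b≢ a₁ a₂ =
      active-idle 0<d a₁
        (subst (Behaves _ _ _ _) (trans (boundPorts-0b (class u₂)) (sym (++-identityʳ _))) a₂)
        (≤-reflexive (cong (λ k → waiting k + 2 ^ k) k≡))
        (λ closer → final-differing b≢ (<⇒≤ closer))
    boundDegrees-differing {zero} {suc zero} {u₁} {u₂} 0<d k≡ b≢ a₁ a₂ =
      subst (λ d → Meets (phase + d * phase) _ _) (dist-sym u₂ u₁)
        (Meets-sym (boundDegrees-differing (subst (0 <_) (dist-sym u₁ u₂) 0<d)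
                     (sym k≡) (≢-sym b≢) a₂ a₁))

    boundDegrees-agreeing : ∀ {n b u₁ u₂ S₁ C₁ S₂ C₂ p₁ p₂} →
      0 < dist u₁ u₂ → class u₁ ≡ class u₂ →
      ¬ Any (Decreasing u₁ u₂) (zip (boundPorts (class u₁) b) (boundPorts (class u₂) b)) →
      Behaves (observe u₁ u₂) S₁ C₁ p₁ (boundPorts (class u₁) b) →
      Behaves (observe u₂ u₁) S₂ C₂ p₂ (boundPorts (class u₂) b) →
      Meets n (C₁ at u₁) (C₂ at u₂) → Meets (phase + n) (p₁ at u₁) (p₂ at u₂)
    boundDegrees-agreeing {n} {b} 0<d k≡ none a₁ a₂ end =
      Meets-mono (+-monoˡ-≤ n (boundPorts-rounds {b = b} 0<d))
        (duel-failure a₁ a₂ (cong (λ k → length (boundPorts k b)) k≡) none end)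

    idle-not-decreasing : ∀ {u₁ u₂} m n →
                          ¬ Any (Decreasing u₁ u₂) (zip (replicate m 0) (replicate n 0))
    idle-not-decreasing (suc m) (suc n) (here d<d)  = n≮n _ d<d
    idle-not-decreasing (suc m) (suc n) (there any) = idle-not-decreasing m n any

    -- The information left by a common failure of `boundDegrees 1b`. It persists during
    -- `compareLabels`, since the agents stay at these nodes while their bits agree.
    Stuck : V → V → Set
    Stuck u₁ u₂ =
      ¬ Any (Decreasing u₁ u₂) (zip (boundPorts (class u₁) 1b) (boundPorts (class u₂) 1b))

    same-bit-not-decreasing : ∀ {u₁ u₂} → Stuck u₁ u₂ → ∀ b →
      ¬ Any (Decreasing u₁ u₂) (zip (boundPorts (class u₁) b) (boundPorts (class u₂) b))
    same-bit-not-decreasing {u₁} {u₂} none zero =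
      subst₂ (λ qs₁ qs₂ → ¬ Any (Decreasing u₁ u₂) (zip qs₁ qs₂))
        (sym (boundPorts-0b (class u₁))) (sym (boundPorts-0b (class u₂))) (idle-not-decreasing _ _)
    same-bit-not-decreasing none (suc zero) = none

    -- Label comparison and search

    module _ {ℓ₁ ℓ₂ p₁ p₂} (str₁ : Structure ℓ₁ p₁) (str₂ : Structure ℓ₂ p₂) where
      private
        module A₁ = Structure str₁
        module A₂ = Structure str₂

      -- The enumeration `f` is general so that the induction can shift it to `f ∘ suc`. Position
      -- `j` need not be the first disagreement; an earlier one only ends the comparison sooner.
      comparing : ∀ {u₁ u₂} → 0 < dist u₁ u₂ → class u₁ ≡ class u₂ → Stuck u₁ u₂ →
        ∀ (f : ℕ → ℕ) j {n₁ n₂} → j < n₁ → j < n₂ → bit (ξ ℓ₁) (f j) ≢ bit (ξ ℓ₂) (f j) →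
        Meets (suc j * phase + dist u₁ u₂ * phase)
              (A₁.comparing (applyUpTo f n₁) at u₁) (A₂.comparing (applyUpTo f n₂) at u₂)
      comparing {u₁} {u₂} 0<d k≡ none f j {suc n₁} {suc n₂} j<n₁ j<n₂ bits≢
        with bit (ξ ℓ₁) (f 0) Fin.≟ bit (ξ ℓ₂) (f 0)
      ... | no  b≢ = Meets-mono (+-monoˡ-≤ _ (m≤m+n phase (j * phase)))
                       (boundDegrees-differing 0<d k≡ b≢
                         (A₁.compares _ (f 0) _) (A₂.compares _ (f 0) _))
      comparing 0<d k≡ none f zero _ _ bits≢ | yes b≡ = contradiction b≡ bits≢
      comparing {u₁} {u₂} 0<d k≡ none f (suc j) {suc n₁} {suc n₂} (s<s j<n₁) (s<s j<n₂) bits≢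
        | yes b≡ =
        Meets-mono (≤-reflexive (sym (+-assoc phase (suc j * phase) _)))
          (boundDegrees-agreeing {b = bit (ξ ℓ₁) (f 0)} 0<d k≡
            (same-bit-not-decreasing none (bit (ξ ℓ₁) (f 0)))
            (A₁.compares _ (f 0) _)
            (subst (λ b → Behaves _ (final b) _ _ (boundPorts (class u₂) b)) (sym b≡)
              (A₂.compares _ (f 0) _))
            (comparing 0<d k≡ none (f ∘ suc) j j<n₁ j<n₂ bits≢))

      module _ {D R}
        (fallback : ∀ {u₁ u₂} →
          0 < dist u₁ u₂ → dist u₁ u₂ ≤ D → class u₁ ≡ class u₂ → Stuck u₁ u₂ →
          Meets R (A₁.comparing (applyUpTo suc (bitLength (ξ ℓ₁))) at u₁)
                  (A₂.comparing (applyUpTo suc (bitLength (ξ ℓ₂))) at u₂)) where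

        searching : ∀ d {u₁ u₂} → dist u₁ u₂ ≤ d → d ≤ D →
                    Meets (d * phase + (phase + R)) (p₁ at u₁) (p₂ at u₂)
        searching d {u₁} {u₂} ≤d d≤D with dist u₁ u₂ ≟ 0
        ... | yes ≡0 = met (dist≡0⇒≡ ≡0)
        searching zero    ≤d d≤D | no ≢0 = contradiction (n≤0⇒n≡0 ≤d) ≢0
        searching (suc d) {u₁} {u₂} ≤d d<D | no ≢0 = attempt
          where
          0<d₁ = n≢0⇒n>0 ≢0
          0<d₂ = subst (0 <_) (dist-sym u₁ u₂) 0<d₁
          a₁ = A₁.searches (observe u₁ u₂) 0<d₁
          a₂ = A₂.searches (observe u₂ u₁) 0<d₂

          onward : ∀ {w₁ w₂} → dist w₁ w₂ < dist u₁ u₂ →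
                   Meets (d * phase + (phase + R)) (p₁ at w₁) (p₂ at w₂)
          onward closer = searching d (s≤s⁻¹ (<-≤-trans closer ≤d)) (<⇒≤ d<D)

          spend : ∀ {c₁ c₂} → Meets (phase + (d * phase + (phase + R))) c₁ c₂ →
                  Meets (suc d * phase + (phase + R)) c₁ c₂
          spend = Meets-mono (≤-reflexive (sym (+-assoc phase (d * phase) (phase + R))))

          attempt : Meets (suc d * phase + (phase + R)) (p₁ at u₁) (p₂ at u₂)
          attempt with <-cmp (class u₁) (class u₂)
          ... | tri< k₁<k₂ _ _ = spend
            (active-idle 0<d₁ a₁ a₂ (boundPorts-length≤waiting k₁<k₂) onward)
          ... | tri> _ _ k₂<k₁ = spend (Meets-sym
            (active-idle 0<d₂ a₂ a₁ (boundPorts-length≤waiting k₂<k₁)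
              (λ closer → Meets-sym (onward (subst₂ _<_ (dist-sym _ _) (dist-sym _ _) closer)))))
          ... | tri≈ _ k≡ _ with any? (decreasing? u₁ u₂)
                                   (zip (boundPorts (class u₁) 1b) (boundPorts (class u₂) 1b))
          ...   | yes any = spend (Meets-mono (+-monoˡ-≤ _ (boundPorts-rounds {b = 1b} 0<d₁))
                              (duel-success a₁ a₂ any onward))
          -- The budget `suc d * phase` for further decreases is given up; the separate `phase` pays
          -- for this failed call.
          ...   | no none = Meets-mono (m≤n+m (phase + R) (suc d * phase))
                              (boundDegrees-agreeing {b = 1b} 0<d₁ k≡ none a₁ a₂
                                (fallback 0<d₁ (≤-trans ≤d d<D) k≡ none))

theorem4p1 : ∃[ C ] ((G : Graph) (P : PortLabelling G)
    (dist : Graph.V G → Graph.V G → ℕ) → IsDistance G dist →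
    (Δ : ℕ) → (∀ v → PortLabelling.deg P v ≤ Δ) →
    (L : ℕ) (ℓ₁ ℓ₂ : Fin L) → ℓ₁ ≢ ℓ₂ →
    (v₁ v₂ : Graph.V G) → v₁ ≢ v₂ →
    let open Execution G P dist in
    RendezvousWithin
    (C * (Δ * (dist v₁ v₂ + (⌊log₂ toℕ ℓ₁ ⌋ ⊓ ⌊log₂ toℕ ℓ₂ ⌋))))
    (start (toℕ ℓ₁) (toℕ ℓ₂) v₁ v₂))
theorem4p1 = 40 , λ G P dist isDistance Δ deg≤Δ L ℓ₁ ℓ₂ ℓ₁≢ℓ₂ v₁ v₂ v₁≢v₂ →
  let open TwoAgents G P dist isDistance
      open Execution G P dist
      D   = dist v₁ v₂
      m   = ⌊log₂ toℕ ℓ₁ ⌋ ⊓ ⌊log₂ toℕ ℓ₂ ⌋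
      0<D = n≢0⇒n>0 (v₁≢v₂ ∘ dist≡0⇒≡)
      str₁ = rendezvous-structure (toℕ ℓ₁)
      str₂ = rendezvous-structure (toℕ ℓ₂)
      j , j<₁ , j<₂ , bits≢ = differing-bit-ξ (ℓ₁≢ℓ₂ ∘ toℕ-injective)
      -- Since `bitLength` is a successor, the minimum of the two lengths is `suc m` by computation,
      -- so this reads `suc j ≤ 2 * suc m`.
      j< = subst (j <_) (sym (*-distribˡ-⊓ 2 (bitLength (toℕ ℓ₁)) (bitLength (toℕ ℓ₂))))
             (⊓-glb j<₁ j<₂)
      meets = searching deg≤Δ str₁ str₂ {D}
        -- The bound from `comparing` involves the distance at the moment of failure; replacing it
        -- by `D` makes it uniform.
        (λ 0<d d≤D k≡ none → Meets-mono (+-monoʳ-≤ _ (*-monoˡ-≤ _ d≤D))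
          (comparing deg≤Δ str₁ str₂ 0<d k≡ none suc j
            (<-≤-trans j<₁ (2*bitLength≤bitLength-ξ (toℕ ℓ₁)))
            (<-≤-trans j<₂ (2*bitLength≤bitLength-ξ (toℕ ℓ₂))) bits≢))
        D ≤-refl ≤-refl
  in subst (λ T → RendezvousWithin T (start (toℕ ℓ₁) (toℕ ℓ₂) v₁ v₂)) (+-identityʳ _)
       (Meets⇒RendezvousWithin (Meets-mono (total-rounds Δ D m 0<D j<) meets))
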